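{- For each $\delta>0$ there is $\epsilon>0$ such that the following holds for every $n\in\mathbb{N}$. If $f\colon\{0,1\}^n\to\{0,1\}$ satisfies \[ \Pr_{\mathbf{x},\mathbf{y}}\big[f(\mathbf{x}\wedge\mathbf{y}) = f(\mathbf{x})\wedge f(\mathbf{y})\big]\ \ge\ 1-\epsilon, \] where $\mathbf{x},\mathbf{y}\in\{0,1\}^n$ are independent and uniformly random, then $f$ is $\delta$-close to a constant function or to an AND function, i.e. there is a function $h$ which is either constant or of the form $h(x)=\bigwedge_{i\in S}x_i$ for some $S\subseteq[n]$, with $\Pr_{\mathbf{x}}[f(\mathbf{x})\neq h(\mathbf{x})]\le\delta$ for uniform $\mathbf{x}$.
   Context: For $x,y\in\{0,1\}^n$, $x\wedge y$ denotes the coordinatewise AND $(x_1\wedge y_1,\ldots,x_n\wedge y_n)$. -}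

module Defs where

open import Data.Bool using (Bool; true; false; _∧_; _∨_; not)
open import Data.Bool.Properties using () renaming (_≟_ to _≟B_)
open import Data.Nat using (ℕ; zero; suc; _^_)
open import Data.Nat.Properties using (m^n≢0)
open import Data.Integer using (+_)
open import Data.Rational using (ℚ; _/_)
open import Data.List using (List; []; _∷_; map; concatMap; filter; length; cartesianProduct)
open import Data.Vec using (Vec; []; _∷_; zipWith)
open import Data.Fin.Subset using (Subset)
open import Data.Product using (_×_; _,_)
open import Relation.Binary.PropositionalEquality using (_≡_)
open import Relation.Nullary using (¬_)
open import Relation.Nullary.Decidable using (¬?)

Cube : ℕ → Set
Cube n = Vec Bool n

allCube : (n : ℕ) → List (Cube n)
allCube zero = [] ∷ []
allCube (suc n) = concatMap (λ v → (false ∷ v) ∷ (true ∷ v) ∷ []) (allCube n)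

_⋀_ : ∀ {n} → Cube n → Cube n → Cube n
x ⋀ y = zipWith _∧_ x y

prAndTest : (n : ℕ) → (Cube n → Bool) → ℚ
prAndTest n f =
  (+ length (filter (λ p → f (Data.Product.proj₁ p ⋀ Data.Product.proj₂ p) ≟B (f (Data.Product.proj₁ p) ∧ f (Data.Product.proj₂ p)))
                    (cartesianProduct (allCube n) (allCube n))))
  / ((2 ^ n) Data.Nat.* (2 ^ n))
  where instance _ = m^n≢0 2 n
                 _ = Data.Nat.Properties.m*n≢0 (2 ^ n) (2 ^ n)

prDisagree : (n : ℕ) → (Cube n → Bool) → (Cube n → Bool) → ℚ
prDisagree n f h =
  (+ length (filter (λ x → ¬? (f x ≟B h x)) (allCube n))) / (2 ^ n)
  where instance _ = m^n≢0 2 n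

andOn : ∀ {n} → Subset n → Cube n → Bool
andOn [] [] = true
andOn (s ∷ S) (x ∷ xs) = (not s ∨ x) ∧ andOn S xs

{-# OPTIONS --safe #-}
module Submission where

-- Write F = f⁻¹(1), and let f have density p (if p ≤ δ, take h = 0). If z ∈ F passes the test
-- against most x, then f(x) = f(z ∧ x) for most x, so f is close to a function of the
-- coordinates in z and its Fourier weight on sets S ⊈ z is small. Averaging over z ∈ F,
-- E = ∑_S f̂(S)² Pr_{z ∈ F}[S ⊈ z] is at most ε/p. Let W be the set of coordinates i with
-- Pr_{z ∈ F}[zᵢ = 0] ≤ 1/4.
--   * For i ∈ W, f̂({i})² ≥ p²/4, so E being small forces z ⊇ W for most z ∈ F.
--   * A set S ⊈ W has Pr_{z ∈ F}[S ⊈ z] ≥ 1/4, so f has little weight on such sets. This weight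
--     bounds (with a factor) the variance of f on the subcube {x ⊇ W}, where f is therefore
--     almost constant, and the constant is 1 since most of F lies there.
-- Hence f is close to the AND over W; ε = δ³/16 suffices.

open import Defs
open import Data.Bool using (Bool; true; false; not; _∧_; _∨_)
open import Data.Bool.Properties using (∧-zeroʳ) renaming (_≟_ to _≟B_)
open import Data.Fin using (Fin; zero; suc)
open import Data.Fin.Subset using (Subset; ⊥; ⁅_⁆)
open import Data.Fin.Subset.Properties using (x∈⁅x⁆)
open import Data.Integer as ℤ using (ℤ; +_; 0ℤ; _+_; _*_; -_; nonNegative; positive)
import Data.Integer.Properties as ℤ
open import Data.Integer.Tactic.RingSolver using (solve-∀)
open import Data.List using (List; []; _∷_; _++_; map; concatMap; filter; length; cartesianProduct)
open import Data.Nat as ℕ using (ℕ; zero; suc)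
import Data.Nat.Properties as ℕ
open import Data.Product using (Σ; ∃; _×_; _,_; proj₁; proj₂)
open import Data.Rational as ℚ using (ℚ; 0ℚ; 1ℚ; _-_; _<_; _≤_; *<*; _/_; fromℚᵘ)
import Data.Rational.Properties as ℚ
open import Data.Rational.Unnormalised using (mkℚᵘ; 1ℚᵘ; *≤*; *<*)
import Data.Rational.Unnormalised.Properties as ℚᵘ
open import Data.Sum using (_⊎_; inj₁; inj₂)
open import Data.Vec using ([]; _∷_; lookup; tabulate)
open import Data.Vec.Properties using (lookup∘tabulate; []=⇒lookup)
open import Function using (_∘_)
open import Relation.Binary.PropositionalEquality
open import Relation.Nullary using (Dec; ¬_; does; yes; no)
open import Relation.Nullary.Decidable using (¬?)
open import Relation.Unary using (Decidable)

private variable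
  n : ℕ
  A B : Set

-- Order arithmetic on the integers.

0≤+ : ∀ {m} → 0ℤ ℤ.≤ + m
0≤+ = ℤ.+≤+ ℕ.z≤n

0≤-* : ∀ {i j} → 0ℤ ℤ.≤ i → 0ℤ ℤ.≤ j → 0ℤ ℤ.≤ i * j
0≤-* {i} {j} p q = subst (ℤ._≤ i * j) (ℤ.*-zeroʳ i) (ℤ.*-monoˡ-≤-nonNeg i {{nonNegative p}} q)

0<-* : ∀ {i j} → 0ℤ ℤ.< i → 0ℤ ℤ.< j → 0ℤ ℤ.< i * j
0<-* {i} {j} p q = subst (ℤ._< i * j) (ℤ.*-zeroʳ i) (ℤ.*-monoˡ-<-pos i {{positive p}} q)

*-monoˡ-≤-0≤ : ∀ {i j k} → 0ℤ ℤ.≤ k → i ℤ.≤ j → k * i ℤ.≤ k * j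
*-monoˡ-≤-0≤ {k = k} p = ℤ.*-monoˡ-≤-nonNeg k {{nonNegative p}}

*-monoʳ-≤-0≤ : ∀ {i j k} → 0ℤ ℤ.≤ k → i ℤ.≤ j → i * k ℤ.≤ j * k
*-monoʳ-≤-0≤ {k = k} p = ℤ.*-monoʳ-≤-nonNeg k {{nonNegative p}}

+-cancelˡ-≤ : ∀ k {i j} → k + i ℤ.≤ k + j → i ℤ.≤ j
+-cancelˡ-≤ k {i} {j} p = subst₂ ℤ._≤_ (cancel k i) (cancel k j) (ℤ.+-monoʳ-≤ (- k) p)
  where
  cancel : ∀ k i → - k + (k + i) ≡ i
  cancel = solve-∀

0≤-square : ∀ i → 0ℤ ℤ.≤ i * i
0≤-square (+ m) = 0≤-* {+ m} {+ m} 0≤+ 0≤+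
0≤-square (ℤ.-[1+ m ]) = 0≤+

-- Indicators and sums over the cube.

⟦_⟧ : Bool → ℤ
⟦ false ⟧ = + 0
⟦ true ⟧ = + 1

0≤⟦_⟧ : ∀ b → 0ℤ ℤ.≤ ⟦ b ⟧
0≤⟦ false ⟧ = ℤ.≤-refl
0≤⟦ true ⟧ = 0≤+

⟦_⟧≤1 : ∀ b → ⟦ b ⟧ ℤ.≤ + 1
⟦ false ⟧≤1 = 0≤+
⟦ true ⟧≤1 = ℤ.≤-refl

-- The two halves are added pointwise before summing, the same shape as `coef`, so that both unfold
-- together in inductions on the dimension.
∑ : (Cube n → ℤ) → ℤ
∑ {zero} g = g []
∑ {suc n} g = ∑ (λ x → g (false ∷ x) + g (true ∷ x))

∑-cong : {g h : Cube n → ℤ} → (∀ x → g x ≡ h x) → ∑ g ≡ ∑ h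
∑-cong {zero} e = e []
∑-cong {suc n} e = ∑-cong {n} (λ x → cong₂ _+_ (e (false ∷ x)) (e (true ∷ x)))

∑-mono : {g h : Cube n → ℤ} → (∀ x → g x ℤ.≤ h x) → ∑ g ℤ.≤ ∑ h
∑-mono {zero} e = e []
∑-mono {suc n} e = ∑-mono {n} (λ x → ℤ.+-mono-≤ (e (false ∷ x)) (e (true ∷ x)))

interchange : ∀ a b c d → (a + b) + (c + d) ≡ (a + c) + (b + d)
interchange = solve-∀

∑-+ : (g h : Cube n → ℤ) → ∑ (λ x → g x + h x) ≡ ∑ g + ∑ h
∑-+ {zero} g h = refl
∑-+ {suc n} g h = trans
  (∑-cong {n} (λ x → interchange (g (false ∷ x)) (h (false ∷ x)) (g (true ∷ x)) (h (true ∷ x))))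
  (∑-+ (λ x → g (false ∷ x) + g (true ∷ x)) _)

∑-*ˡ : ∀ k (g : Cube n → ℤ) → ∑ (λ x → k * g x) ≡ k * ∑ g
∑-*ˡ {zero} k g = refl
∑-*ˡ {suc n} k g = trans (∑-cong {n} (λ x → sym (ℤ.*-distribˡ-+ k (g (false ∷ x)) (g (true ∷ x))))) (∑-*ˡ {n} k _)

∑-nonneg : {g : Cube n → ℤ} → (∀ x → 0ℤ ℤ.≤ g x) → 0ℤ ℤ.≤ ∑ g
∑-nonneg {zero} p = p []
∑-nonneg {suc n} p = ∑-nonneg {n} (λ x → ℤ.+-mono-≤ (p (false ∷ x)) (p (true ∷ x)))

∑-swap : ∀ {m} (F : Cube n → Cube m → ℤ) → ∑ (λ x → ∑ (F x)) ≡ ∑ (λ y → ∑ (λ x → F x y))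
∑-swap {zero} F = refl
∑-swap {suc n} F = trans
  (∑-cong {n} (λ x → sym (∑-+ (F (false ∷ x)) (F (true ∷ x)))))
  (∑-swap (λ x y → F (false ∷ x) y + F (true ∷ x) y))

term≤∑ : {g : Cube n → ℤ} → (∀ x → 0ℤ ℤ.≤ g x) → ∀ x → g x ℤ.≤ ∑ g
term≤∑ p [] = ℤ.≤-refl
term≤∑ {g = g} p (b ∷ x) = ℤ.≤-trans (one b)
  (term≤∑ {g = λ x → g (false ∷ x) + g (true ∷ x)} (λ x → ℤ.+-mono-≤ (p (false ∷ x)) (p (true ∷ x))) x)
  where
  one : ∀ b → g (b ∷ x) ℤ.≤ g (false ∷ x) + g (true ∷ x)
  one false = subst (ℤ._≤ g (false ∷ x) + g (true ∷ x)) (ℤ.+-identityʳ _) (ℤ.+-monoʳ-≤ (g (false ∷ x)) (p (true ∷ x)))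
  one true = subst (ℤ._≤ g (false ∷ x) + g (true ∷ x)) (ℤ.+-identityˡ _) (ℤ.+-monoˡ-≤ (g (true ∷ x)) (p (false ∷ x)))

-- This is 2^n, written as a sum so that comparing a count with 2^n is an instance of `∑-mono`.
pw : ℕ → ℤ
pw n = ∑ {n} (λ _ → + 1)

pw-suc : ∀ n → pw (suc n) ≡ + 2 * pw n
pw-suc n = ∑-*ˡ {n} (+ 2) (λ _ → + 1)

0≤pw : ∀ n → 0ℤ ℤ.≤ pw n
0≤pw n = ∑-nonneg {n} (λ _ → 0≤+)

-- Fourier analysis on the cube.

-- Walsh–Fourier coefficients, scaled by 2^n and with sign (-1)^|S|, so that all stay integers.
coef : (Cube n → ℤ) → Subset n → ℤ
coef g [] = g []
coef g (false ∷ S) = coef (λ x → g (true ∷ x) + g (false ∷ x)) S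
coef g (true ∷ S) = coef (λ x → g (true ∷ x) + - g (false ∷ x)) S

coef-cong : {g h : Cube n → ℤ} → (∀ x → g x ≡ h x) → ∀ S → coef g S ≡ coef h S
coef-cong e [] = e []
coef-cong e (false ∷ S) = coef-cong (λ x → cong₂ _+_ (e (true ∷ x)) (e (false ∷ x))) S
coef-cong e (true ∷ S) = coef-cong (λ x → cong₂ (λ u v → u + - v) (e (true ∷ x)) (e (false ∷ x))) S

interchange-− : ∀ a b c d → (a + b) + - (c + d) ≡ (a + - c) + (b + - d)
interchange-− = solve-∀

neg-distrib-+ : ∀ a b → - a + - b ≡ - (a + b)
neg-distrib-+ = solve-∀

coef-+ : (g h : Cube n → ℤ) → ∀ S → coef (λ x → g x + h x) S ≡ coef g S + coef h S
coef-+ g h [] = refl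
coef-+ g h (false ∷ S) = trans
  (coef-cong (λ x → interchange (g (true ∷ x)) (h (true ∷ x)) (g (false ∷ x)) (h (false ∷ x))) S)
  (coef-+ (λ x → g (true ∷ x) + g (false ∷ x)) _ S)
coef-+ g h (true ∷ S) = trans
  (coef-cong (λ x → interchange-− (g (true ∷ x)) (h (true ∷ x)) (g (false ∷ x)) (h (false ∷ x))) S)
  (coef-+ (λ x → g (true ∷ x) + - g (false ∷ x)) _ S)

coef-neg : (g : Cube n → ℤ) → ∀ S → coef (λ x → - g x) S ≡ - coef g S
coef-neg g [] = refl
coef-neg g (false ∷ S) = trans
  (coef-cong (λ x → neg-distrib-+ (g (true ∷ x)) (g (false ∷ x))) S)
  (coef-neg (λ x → g (true ∷ x) + g (false ∷ x)) S)
coef-neg g (true ∷ S) = trans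
  (coef-cong (λ x → neg-distrib-+ (g (true ∷ x)) (- g (false ∷ x))) S)
  (coef-neg (λ x → g (true ∷ x) + - g (false ∷ x)) S)

coef-− : (g h : Cube n → ℤ) → ∀ S → coef (λ x → g x + - h x) S ≡ coef g S + - coef h S
coef-− g h S = trans (coef-+ g (-_ ∘ h) S) (cong (λ c → coef g S + c) (coef-neg h S))

coef-zero : {g : Cube n → ℤ} → (∀ x → g x ≡ 0ℤ) → ∀ S → coef g S ≡ 0ℤ
coef-zero e [] = e []
coef-zero e (false ∷ S) = coef-zero (λ x → cong₂ _+_ (e (true ∷ x)) (e (false ∷ x))) S
coef-zero e (true ∷ S) = coef-zero (λ x → cong₂ (λ u v → u + - v) (e (true ∷ x)) (e (false ∷ x))) S

coef-⊥ : (g : Cube n → ℤ) → coef g ⊥ ≡ ∑ g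
coef-⊥ {zero} g = refl
coef-⊥ {suc n} g = trans (coef-⊥ (λ x → g (true ∷ x) + g (false ∷ x)))
  (∑-cong {n} (λ x → ℤ.+-comm (g (true ∷ x)) (g (false ∷ x))))

weight : (Cube n → ℤ) → Subset n → ℤ
weight g S = coef g S * coef g S

0≤weight : (g : Cube n → ℤ) → ∀ S → 0ℤ ℤ.≤ weight g S
0≤weight g S = 0≤-square (coef g S)

parallelogram : ∀ a b → (b + a) * (b + a) + (b + - a) * (b + - a) ≡ + 2 * (a * a + b * b)
parallelogram = solve-∀

-- Each coordinate contributes one use of the parallelogram identity. Coefficients carry a factor
-- 2^n, so the usual mean of g² turns into 2^n times its sum.
parseval : (g : Cube n → ℤ) → ∑ (weight g) ≡ pw n * ∑ (λ x → g x * g x)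
parseval {zero} g = sym (ℤ.*-identityˡ _)
parseval {suc n} g = begin
  ∑ (λ S → weight g₊ S + weight g₋ S)
    ≡⟨ ∑-+ (weight g₊) (weight g₋) ⟩
  ∑ (weight g₊) + ∑ (weight g₋)
    ≡⟨ cong₂ _+_ (parseval g₊) (parseval g₋) ⟩
  pw n * ∑ (λ x → g₊ x * g₊ x) + pw n * ∑ (λ x → g₋ x * g₋ x)
    ≡⟨ ℤ.*-distribˡ-+ (pw n) _ _ ⟨
  pw n * (∑ (λ x → g₊ x * g₊ x) + ∑ (λ x → g₋ x * g₋ x))
    ≡⟨ cong (pw n *_) (∑-+ (λ x → g₊ x * g₊ x) (λ x → g₋ x * g₋ x)) ⟨
  pw n * ∑ (λ x → g₊ x * g₊ x + g₋ x * g₋ x)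
    ≡⟨ cong (pw n *_) (trans (∑-cong {n} (λ x → parallelogram (g (false ∷ x)) (g (true ∷ x)))) (∑-*ˡ {n} (+ 2) sq)) ⟩
  pw n * (+ 2 * ∑ sq)
    ≡⟨ assoc-comm (pw n) (+ 2) (∑ sq) ⟩
  + 2 * pw n * ∑ sq
    ≡⟨ cong (_* ∑ sq) (pw-suc n) ⟨
  pw (suc n) * ∑ sq ∎
  where
  open ≡-Reasoning
  g₊ g₋ sq : Cube n → ℤ
  g₊ x = g (true ∷ x) + g (false ∷ x)
  g₋ x = g (true ∷ x) + - g (false ∷ x)
  sq x = g (false ∷ x) * g (false ∷ x) + g (true ∷ x) * g (true ∷ x)
  assoc-comm : ∀ a b c → a * (b * c) ≡ b * a * c
  assoc-comm = solve-∀

-- With the sign used in `coef`, the character of {i} is 1 where xᵢ = 1 and -1 where xᵢ = 0.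
coef-⁅⁆ : (g : Cube n → ℤ) (i : Fin n) →
  coef g ⁅ i ⁆ ≡ ∑ g + - (+ 2 * ∑ (λ x → g x * ⟦ not (lookup x i) ⟧))
coef-⁅⁆ {suc n} g zero = begin
  coef (λ x → g (true ∷ x) + - g (false ∷ x)) ⊥
    ≡⟨ coef-− (g ∘ (true ∷_)) (g ∘ (false ∷_)) ⊥ ⟩
  coef (g ∘ (true ∷_)) ⊥ + - coef (g ∘ (false ∷_)) ⊥
    ≡⟨ cong₂ (λ u v → u + - v) (coef-⊥ (g ∘ (true ∷_))) (coef-⊥ (g ∘ (false ∷_))) ⟩
  ∑ (g ∘ (true ∷_)) + - ∑ (g ∘ (false ∷_))
    ≡⟨ reflect (∑ (g ∘ (true ∷_))) (∑ (g ∘ (false ∷_))) ⟩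
  (∑ (g ∘ (false ∷_)) + ∑ (g ∘ (true ∷_))) + - (+ 2 * ∑ (g ∘ (false ∷_)))
    ≡⟨ cong₂ (λ u v → u + - (+ 2 * v)) (sym (∑-+ (g ∘ (false ∷_)) (g ∘ (true ∷_))))
         (∑-cong {n} (λ x → mask (g (false ∷ x)) (g (true ∷ x)))) ⟩
  ∑ g + - (+ 2 * ∑ (λ x → g x * ⟦ not (lookup x zero) ⟧)) ∎
  where
  open ≡-Reasoning
  reflect : ∀ a b → a + - b ≡ (b + a) + - (+ 2 * b)
  reflect = solve-∀
  mask : ∀ a b → a ≡ a * + 1 + b * + 0
  mask = solve-∀
coef-⁅⁆ {suc n} g (suc i) = trans (coef-⁅⁆ _ i) (cong₂ (λ u v → u + - (+ 2 * v))
  (∑-cong {n} (λ x → ℤ.+-comm (g (true ∷ x)) (g (false ∷ x))))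
  (∑-cong {n} (λ x → distrib (g (true ∷ x)) (g (false ∷ x)) ⟦ not (lookup x i) ⟧)))
  where
  distrib : ∀ a b c → (a + b) * c ≡ b * c + a * c
  distrib = solve-∀

-- The hypothesis reads S ⊈ z. Some i ∈ S has zᵢ = 0, so the function ignores xᵢ and its difference
-- in direction i is zero.
coef-restricted : (g : Cube n → ℤ) (z : Cube n) (S : Subset n) → andOn S z ≡ false →
  coef (λ x → g (z ⋀ x)) S ≡ 0ℤ
coef-restricted g [] [] ()
coef-restricted g (true ∷ z) (false ∷ S) p = coef-restricted (λ x → g (true ∷ x) + g (false ∷ x)) z S p
coef-restricted g (true ∷ z) (true ∷ S) p = coef-restricted (λ x → g (true ∷ x) + - g (false ∷ x)) z S p
coef-restricted g (false ∷ z) (false ∷ S) p = coef-restricted (λ x → g (false ∷ x) + g (false ∷ x)) z S p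
coef-restricted g (false ∷ z) (true ∷ S) p = coef-zero (λ x → ℤ.+-inverseʳ (g (false ∷ (z ⋀ x)))) S

-- Subtracting the function x ↦ g (z ⋀ x), whose spectrum lives on subsets of z, does not
-- change the weight outside z.
weight-outside : (g : Cube n → ℤ) (z : Cube n) →
  ∑ (λ S → ⟦ not (andOn S z) ⟧ * weight g S) ℤ.≤
  pw n * ∑ (λ x → (g x + - g (z ⋀ x)) * (g x + - g (z ⋀ x)))
weight-outside {n} g z = ℤ.≤-trans (∑-mono {n} pointwise) (ℤ.≤-reflexive (parseval d))
  where
  d : Cube n → ℤ
  d x = g x + - g (z ⋀ x)
  pointwise : ∀ S → ⟦ not (andOn S z) ⟧ * weight g S ℤ.≤ weight d S
  pointwise S with andOn S z in eq
  ... | true = 0≤weight d S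
  ... | false = ℤ.≤-reflexive (trans (ℤ.*-identityˡ _) (cong (λ c → c * c) (sym {y = coef g S}
          (trans (coef-− g (λ x → g (z ⋀ x)) S)
            (trans (cong (λ c → coef g S + - c) (coef-restricted g z S eq)) (ℤ.+-identityʳ _))))))

-- Once the first product on the right is moved over, the left is the variance of g on {x ⊇ W},
-- times the squared size of that subcube. By induction on coordinates: one in W restricts g to its
-- upper half; one outside W splits g into a sum and a difference of halves.
variance≤weight-outside : (g : Cube n → ℤ) (W : Subset n) →
  ∑ (λ x → ⟦ andOn W x ⟧) * ∑ (λ x → ⟦ andOn W x ⟧ * (g x * g x)) ℤ.≤
  ∑ (λ x → ⟦ andOn W x ⟧ * g x) * ∑ (λ x → ⟦ andOn W x ⟧ * g x)
    + ∑ (λ S → ⟦ not (andOn S W) ⟧ * weight g S)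
variance≤weight-outside {zero} g [] = ℤ.≤-reflexive (base (g []))
  where
  base : ∀ a → + 1 * (+ 1 * (a * a)) ≡ (+ 1 * a) * (+ 1 * a) + + 0
  base = solve-∀
variance≤weight-outside {suc n} g (true ∷ W) = begin
  ∑ (λ x → + 0 + ⟦ andOn W x ⟧) * ∑ (λ x → + 0 + ⟦ andOn W x ⟧ * (g₁ x * g₁ x))
    ≡⟨ cong₂ _*_ (∑-cong {n} (λ x → ℤ.+-identityˡ _)) (∑-cong {n} (λ x → ℤ.+-identityˡ _)) ⟩
  ∑ (λ x → ⟦ andOn W x ⟧) * ∑ (λ x → ⟦ andOn W x ⟧ * (g₁ x * g₁ x))
    ≤⟨ variance≤weight-outside g₁ W ⟩
  ∑ (λ x → ⟦ andOn W x ⟧ * g₁ x) * ∑ (λ x → ⟦ andOn W x ⟧ * g₁ x)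
    + ∑ (λ S → ⟦ not (andOn S W) ⟧ * weight g₁ S)
    ≤⟨ ℤ.+-mono-≤ (ℤ.≤-reflexive (cong (λ s → s * s) (∑-cong {n} (λ x → sym (ℤ.+-identityˡ _)))))
         (∑-mono {n} pointwise) ⟩
  ∑ (λ x → + 0 + ⟦ andOn W x ⟧ * g₁ x) * ∑ (λ x → + 0 + ⟦ andOn W x ⟧ * g₁ x)
    + ∑ (λ S → ⟦ not (andOn S W) ⟧ * weight g₊ S + ⟦ not (andOn S W) ⟧ * weight g₋ S) ∎
  where
  open ℤ.≤-Reasoning
  g₀ g₁ g₊ g₋ : Cube n → ℤ
  g₀ x = g (false ∷ x)
  g₁ x = g (true ∷ x)
  g₊ x = g₁ x + g₀ x
  g₋ x = g₁ x + - g₀ x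
  expand : ∀ i a b → i * ((b + a) * (b + a)) + i * ((b + - a) * (b + - a))
    ≡ i * (b * b) + i * (+ 2 * (a * a) + b * b)
  expand = solve-∀
  pointwise : ∀ S → ⟦ not (andOn S W) ⟧ * weight g₁ S ℤ.≤
    ⟦ not (andOn S W) ⟧ * weight g₊ S + ⟦ not (andOn S W) ⟧ * weight g₋ S
  -- The halves satisfy (c₁ + c₀)² + (c₁ - c₀)² = 2c₁² + 2c₀², which dominates c₁².
  pointwise S = begin
    i * (c₁ * c₁)
      ≡⟨ ℤ.+-identityʳ _ ⟨
    i * (c₁ * c₁) + + 0
      ≤⟨ ℤ.+-monoʳ-≤ (i * (c₁ * c₁)) (0≤-* 0≤⟦ not (andOn S W) ⟧
           (ℤ.+-mono-≤ (0≤-* {+ 2} 0≤+ (0≤-square c₀)) (0≤-square c₁))) ⟩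
    i * (c₁ * c₁) + i * (+ 2 * (c₀ * c₀) + c₁ * c₁)
      ≡⟨ expand i c₀ c₁ ⟨
    i * ((c₁ + c₀) * (c₁ + c₀)) + i * ((c₁ + - c₀) * (c₁ + - c₀))
      ≡⟨ cong₂ (λ u v → i * (u * u) + i * (v * v)) (coef-+ g₁ g₀ S) (coef-− g₁ g₀ S) ⟨
    i * weight g₊ S + i * weight g₋ S ∎
    where
    i = ⟦ not (andOn S W) ⟧
    c₀ = coef g₀ S
    c₁ = coef g₁ S
variance≤weight-outside {suc n} g (false ∷ W) = begin
  ∑ (λ x → u x + u x) * ∑ (λ x → u x * (g₀ x * g₀ x) + u x * (g₁ x * g₁ x))
    ≡⟨ cong (_* T) (∑-+ u u) ⟩
  (m + m) * T
    ≡⟨ double m T ⟩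
  m * (+ 2 * T)
    -- The parallelogram identity distributes the second moment over the sum `g₊` and the difference
    -- `g₋`.
    ≡⟨ cong (m *_) (trans (sym (∑-*ˡ {n} (+ 2) _)) (trans
         (∑-cong {n} (λ x → expand (u x) (g₀ x) (g₁ x))) (∑-+ (λ x → u x * (g₊ x * g₊ x)) _))) ⟩
  m * (P + Q)
    ≡⟨ ℤ.*-distribˡ-+ m P Q ⟩
  m * P + m * Q
    -- Induction handles `g₊`. All of `g₋` is charged to sets containing the current coordinate,
    -- none of which lies inside W.
    ≤⟨ ℤ.+-mono-≤ (variance≤weight-outside g₊ W) mQ≤ ⟩
  s * s + R₊ + ∑ (weight g₋)
    ≡⟨ ℤ.+-assoc (s * s) R₊ _ ⟩
  s * s + (R₊ + ∑ (weight g₋))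
    ≡⟨ cong₂ (λ a b → a * a + b)
         (∑-cong {n} (λ x → distrib (u x) (g₀ x) (g₁ x)))
         (trans (cong (λ c → R₊ + c) (∑-cong {n} (λ S → sym (ℤ.*-identityˡ _)))) (sym (∑-+ r₊ _))) ⟩
  s' * s' + ∑ (λ S → r₊ S + + 1 * weight g₋ S) ∎
  where
  open ℤ.≤-Reasoning
  g₀ g₁ g₊ g₋ u r₊ : Cube n → ℤ
  g₀ x = g (false ∷ x)
  g₁ x = g (true ∷ x)
  g₊ x = g₁ x + g₀ x
  g₋ x = g₁ x + - g₀ x
  u x = ⟦ andOn W x ⟧
  r₊ S = ⟦ not (andOn S W) ⟧ * weight g₊ S
  m = ∑ u
  T = ∑ (λ x → u x * (g₀ x * g₀ x) + u x * (g₁ x * g₁ x))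
  P = ∑ (λ x → u x * (g₊ x * g₊ x))
  Q = ∑ (λ x → u x * (g₋ x * g₋ x))
  s = ∑ (λ x → u x * g₊ x)
  s' = ∑ (λ x → u x * g₀ x + u x * g₁ x)
  R₊ = ∑ r₊
  double : ∀ m t → (m + m) * t ≡ m * (+ 2 * t)
  double = solve-∀
  expand : ∀ u a b → + 2 * (u * (a * a) + u * (b * b)) ≡
    u * ((b + a) * (b + a)) + u * ((b + - a) * (b + - a))
  expand = solve-∀
  distrib : ∀ u a b → u * (b + a) ≡ u * a + u * b
  distrib = solve-∀
  0≤sq : ∀ x → 0ℤ ℤ.≤ g₋ x * g₋ x
  0≤sq x = 0≤-square (g₋ x)
  mQ≤ : m * Q ℤ.≤ ∑ (weight g₋)
  mQ≤ = begin
    m * Q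
      ≤⟨ *-monoʳ-≤-0≤ (∑-nonneg {n} (λ x → 0≤-* 0≤⟦ andOn W x ⟧ (0≤sq x))) (∑-mono {n} (λ x → ⟦ andOn W x ⟧≤1)) ⟩
    pw n * Q
      ≤⟨ *-monoˡ-≤-0≤ (0≤pw n) (∑-mono {n} (λ x → ℤ.≤-trans (*-monoʳ-≤-0≤ (0≤sq x) ⟦ andOn W x ⟧≤1)
           (ℤ.≤-reflexive (ℤ.*-identityˡ _)))) ⟩
    pw n * ∑ (λ x → g₋ x * g₋ x)
      ≡⟨ parseval g₋ ⟨
    ∑ (weight g₋) ∎

andOn-lookup : (S z : Cube n) (i : Fin n) → lookup S i ≡ true → lookup z i ≡ false → andOn S z ≡ false
andOn-lookup (true ∷ S) (false ∷ z) zero _ _ = refl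
andOn-lookup (s ∷ S) (x ∷ z) (suc i) p q =
  trans (cong ((not s ∨ x) ∧_) (andOn-lookup S z i p q)) (∧-zeroʳ (not s ∨ x))

-- Read as containment, S ⊈ z has a single coordinate as witness; this ties the spectrum to the
-- coordinatewise definition of `W`.
andOn-false : (S z : Cube n) → andOn S z ≡ false → ∃ λ i → lookup S i ≡ true × lookup z i ≡ false
andOn-false [] [] ()
andOn-false (true ∷ S) (false ∷ z) p = zero , refl , refl
andOn-false (true ∷ S) (true ∷ z) p = let i , q = andOn-false S z p in suc i , q
andOn-false (false ∷ S) (x ∷ z) p = let i , q = andOn-false S z p in suc i , q

-- Spectral consequences of the test for a fixed f.

module Test (f : Cube n → Bool) where

  F : Cube n → ℤ
  F x = ⟦ f x ⟧

  0≤F : ∀ x → 0ℤ ℤ.≤ F x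
  0≤F x = 0≤⟦ f x ⟧

  size : ℤ
  size = ∑ F

  0≤size : 0ℤ ℤ.≤ size
  0≤size = ∑-nonneg {n} 0≤F

  avoiding : Fin n → ℤ
  avoiding i = ∑ (λ z → F z * ⟦ not (lookup z i) ⟧)

  -- Like `avoiding`, a probability over z ∈ F multiplied by `size`.
  uncovering : Subset n → ℤ
  uncovering S = ∑ (λ z → F z * ⟦ not (andOn S z) ⟧)

  passes : Cube n → Cube n → Bool
  passes z x = does (f (z ⋀ x) ≟B (f z ∧ f x))

  failures : ℤ
  failures = ∑ (λ z → ∑ (λ x → ⟦ not (passes z x) ⟧))

  -- The quantity E multiplied by 4^n and by `size`, since `coef` is 2^n f̂ up to sign.
  energy : ℤ
  energy = ∑ (λ S → weight F S * uncovering S)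

  -- Exchanging the sums gives, for each z ∈ F, the weight of F outside z. This is at most 2^n times
  -- the number of x at which f(x) and f(z ∧ x) differ.
  energy≤failures : energy ℤ.≤ pw n * failures
  energy≤failures = begin
    ∑ (λ S → weight F S * uncovering S)
      ≡⟨ ∑-cong {n} (λ S → sym (∑-*ˡ {n} (weight F S) _)) ⟩
    ∑ (λ S → ∑ (λ z → weight F S * (F z * ⟦ not (andOn S z) ⟧)))
      ≡⟨ ∑-swap {n} {n} (λ S z → weight F S * (F z * ⟦ not (andOn S z) ⟧)) ⟩
    ∑ (λ z → ∑ (λ S → weight F S * (F z * ⟦ not (andOn S z) ⟧)))
      ≡⟨ ∑-cong {n} (λ z → trans
           (∑-cong {n} (λ S → rotate (weight F S) (F z) ⟦ not (andOn S z) ⟧)) (∑-*ˡ {n} (F z) _)) ⟩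
    ∑ (λ z → F z * ∑ (λ S → ⟦ not (andOn S z) ⟧ * weight F S))
      ≤⟨ ∑-mono {n} (λ z → *-monoˡ-≤-0≤ (0≤F z) (weight-outside F z)) ⟩
    ∑ (λ z → F z * (pw n * ∑ (change z)))
      ≡⟨ ∑-cong {n} (λ z → trans (exchange (F z) (pw n) (∑ (change z)))
           (cong (pw n *_) (sym (∑-*ˡ {n} (F z) (change z))))) ⟩
    ∑ (λ z → pw n * ∑ (λ x → F z * change z x))
      ≡⟨ ∑-*ˡ {n} (pw n) _ ⟩
    pw n * ∑ (λ z → ∑ (λ x → F z * change z x))
      ≤⟨ *-monoˡ-≤-0≤ (0≤pw n) (∑-mono {n} (λ z → ∑-mono {n} (pointwise z))) ⟩
    pw n * failures ∎
    where
    open ℤ.≤-Reasoning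
    change : Cube n → Cube n → ℤ
    change z x = (F x + - F (z ⋀ x)) * (F x + - F (z ⋀ x))
    rotate : ∀ w a b → w * (a * b) ≡ a * (b * w)
    rotate = solve-∀
    exchange : ∀ a b c → a * (b * c) ≡ b * (a * c)
    exchange = solve-∀
    pointwise : ∀ z x → F z * change z x ℤ.≤ ⟦ not (passes z x) ⟧
    -- For z ∈ F the test at (z, x) asks exactly whether f(z ∧ x) = f(x); for z outside F the left
    -- side is 0.
    pointwise z x with f z | f x | f (z ⋀ x)
    ... | false | _ | false = ℤ.≤-refl
    ... | false | _ | true = 0≤+
    ... | true | false | false = ℤ.≤-refl
    ... | true | false | true = ℤ.≤-refl
    ... | true | true | false = ℤ.≤-refl
    ... | true | true | true = ℤ.≤-refl

  -- The threshold 1/4 is below 1/2, which keeps the singleton coefficients in `W` away from 0, and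
  -- above 0, which makes coordinates outside `W` often absent from z ∈ F.
  W : Subset n
  W = tabulate (λ i → does (+ 4 * avoiding i ℤ.≤? size))

  inside-W : ∀ i → lookup W i ≡ true → + 4 * avoiding i ℤ.≤ size
  inside-W i p with + 4 * avoiding i ℤ.≤? size | trans (sym (lookup∘tabulate _ i)) p
  ... | yes q | _ = q

  outside-W : ∀ i → lookup W i ≡ false → size ℤ.≤ + 4 * avoiding i
  outside-W i p with + 4 * avoiding i ℤ.≤? size | trans (sym (lookup∘tabulate _ i)) p
  ... | no q | _ = ℤ.<⇒≤ (ℤ.≰⇒> q)

  -- A coordinate i ∈ W ∖ z has the large coefficient size − 2 (avoiding i), and ⁅ i ⁆ ⊈ z.
  size²-uncovering : size * size * uncovering W ℤ.≤ + 4 * energy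
  size²-uncovering = begin
    size * size * uncovering W
      ≡⟨ ∑-*ˡ {n} (size * size) _ ⟨
    ∑ (λ z → size * size * (F z * ⟦ not (andOn W z) ⟧))
      ≤⟨ ∑-mono {n} pointwise ⟩
    ∑ (λ z → + 4 * ∑ (λ S → weight F S * (F z * ⟦ not (andOn S z) ⟧)))
      ≡⟨ ∑-*ˡ {n} (+ 4) _ ⟩
    + 4 * ∑ (λ z → ∑ (λ S → weight F S * (F z * ⟦ not (andOn S z) ⟧)))
      ≡⟨ cong (+ 4 *_) (∑-swap {n} {n} (λ z S → weight F S * (F z * ⟦ not (andOn S z) ⟧))) ⟩
    + 4 * ∑ (λ S → ∑ (λ z → weight F S * (F z * ⟦ not (andOn S z) ⟧)))
      ≡⟨ cong (+ 4 *_) (∑-cong {n} (λ S → ∑-*ˡ {n} (weight F S) _)) ⟩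
    + 4 * energy ∎
    where
    open ℤ.≤-Reasoning
    twice : ∀ a k → (a + (a + - (+ 4 * k))) * (a + (a + - (+ 4 * k))) ≡
      + 4 * ((a + - (+ 2 * k)) * (a + - (+ 2 * k)))
    twice = solve-∀
    a≤a+ : ∀ {a d} → 0ℤ ℤ.≤ d → a ℤ.≤ a + d
    a≤a+ {a} {d} p = subst (ℤ._≤ a + d) (ℤ.+-identityʳ a) (ℤ.+-monoʳ-≤ a p)
    nonneg : ∀ z S → 0ℤ ℤ.≤ weight F S * (F z * ⟦ not (andOn S z) ⟧)
    nonneg z S = 0≤-* (0≤weight F S) (0≤-* (0≤F z) 0≤⟦ not (andOn S z) ⟧)
    large : ∀ i → lookup W i ≡ true → size * size ℤ.≤ + 4 * weight F ⁅ i ⁆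
    large i p = begin
      size * size
        ≤⟨ *-monoˡ-≤-0≤ 0≤size le ⟩
      size * b
        ≤⟨ *-monoʳ-≤-0≤ (ℤ.≤-trans 0≤size le) le ⟩
      b * b
        ≡⟨ twice size (avoiding i) ⟩
      + 4 * ((size + - (+ 2 * avoiding i)) * (size + - (+ 2 * avoiding i)))
        ≡⟨ cong (λ c → + 4 * (c * c)) (coef-⁅⁆ F i) ⟨
      + 4 * weight F ⁅ i ⁆ ∎
      where
      -- Twice the coefficient at ⁅ i ⁆, arranged so that the bracket is nonnegative for i ∈ W.
      b = size + (size + - (+ 4 * avoiding i))
      le : size ℤ.≤ b
      le = a≤a+ (ℤ.i≤j⇒0≤j-i (inside-W i p))
    pointwise : ∀ z → size * size * (F z * ⟦ not (andOn W z) ⟧) ℤ.≤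
      + 4 * ∑ (λ S → weight F S * (F z * ⟦ not (andOn S z) ⟧))
    pointwise z with andOn W z in eq
    ... | true = ℤ.≤-trans (ℤ.≤-reflexive (vanish (size * size) (F z)))
                   (0≤-* {+ 4} 0≤+ (∑-nonneg {n} (nonneg z)))
      where
      vanish : ∀ a b → a * (b * + 0) ≡ + 0
      vanish = solve-∀
    ... | false = let i , p , q = andOn-false W z eq in begin
      size * size * (F z * + 1)
        ≤⟨ *-monoʳ-≤-0≤ (0≤-* (0≤F z) 0≤+) (large i p) ⟩
      + 4 * weight F ⁅ i ⁆ * (F z * + 1)
        ≡⟨ ℤ.*-assoc (+ 4) (weight F ⁅ i ⁆) _ ⟩
      + 4 * (weight F ⁅ i ⁆ * (F z * + 1))
        ≡⟨ cong (λ b → + 4 * (weight F ⁅ i ⁆ * (F z * ⟦ not b ⟧)))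
             (andOn-lookup ⁅ i ⁆ z i ([]=⇒lookup (x∈⁅x⁆ i)) q) ⟨
      + 4 * (weight F ⁅ i ⁆ * (F z * ⟦ not (andOn ⁅ i ⁆ z) ⟧))
        -- All terms are nonnegative, so the single set ⁅ i ⁆ bounds the whole sum from below.
        ≤⟨ *-monoˡ-≤-0≤ {k = + 4} 0≤+ (term≤∑ (nonneg z) ⁅ i ⁆) ⟩
      + 4 * ∑ (λ S → weight F S * (F z * ⟦ not (andOn S z) ⟧)) ∎

  weight-outside-W : ℤ
  weight-outside-W = ∑ (λ S → ⟦ not (andOn S W) ⟧ * weight F S)

  -- If S ⊈ W, some i ∈ S lies outside W. Every z ∈ F with zᵢ = 0 fails to contain S, and these z
  -- make up at least a quarter of F.
  size-weight-outside-W : size * weight-outside-W ℤ.≤ + 4 * energy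
  size-weight-outside-W = begin
    size * weight-outside-W
      ≡⟨ ∑-*ˡ {n} size _ ⟨
    ∑ (λ S → size * (⟦ not (andOn S W) ⟧ * weight F S))
      ≤⟨ ∑-mono {n} pointwise ⟩
    ∑ (λ S → + 4 * (weight F S * uncovering S))
      ≡⟨ ∑-*ˡ {n} (+ 4) _ ⟩
    + 4 * energy ∎
    where
    open ℤ.≤-Reasoning
    rearrange : ∀ w k → + 4 * k * (+ 1 * w) ≡ + 4 * (w * k)
    rearrange = solve-∀
    0≤uncovering : ∀ S → 0ℤ ℤ.≤ uncovering S
    0≤uncovering S = ∑-nonneg {n} (λ z → 0≤-* (0≤F z) 0≤⟦ not (andOn S z) ⟧)
    avoiding≤uncovering : ∀ S i → lookup S i ≡ true → avoiding i ℤ.≤ uncovering S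
    avoiding≤uncovering S i p = ∑-mono {n} (λ z → *-monoˡ-≤-0≤ (0≤F z) (le z))
      where
      le : ∀ z → ⟦ not (lookup z i) ⟧ ℤ.≤ ⟦ not (andOn S z) ⟧
      le z with lookup z i in eq
      ... | true = 0≤⟦ not (andOn S z) ⟧
      ... | false = ℤ.≤-reflexive (cong (⟦_⟧ ∘ not) (sym (andOn-lookup S z i p eq)))
    pointwise : ∀ S → size * (⟦ not (andOn S W) ⟧ * weight F S) ℤ.≤ + 4 * (weight F S * uncovering S)
    pointwise S with andOn S W in eq
    ... | true = ℤ.≤-trans (ℤ.≤-reflexive (ℤ.*-zeroʳ size))
                   (0≤-* {+ 4} 0≤+ (0≤-* (0≤weight F S) (0≤uncovering S)))
    ... | false = let i , p , q = andOn-false S W eq in begin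
      size * (+ 1 * weight F S)
        ≤⟨ *-monoʳ-≤-0≤ (0≤-* {+ 1} 0≤+ (0≤weight F S)) (outside-W i q) ⟩
      + 4 * avoiding i * (+ 1 * weight F S)
        ≡⟨ rearrange (weight F S) (avoiding i) ⟩
      + 4 * (weight F S * avoiding i)
        ≤⟨ *-monoˡ-≤-0≤ {k = + 4} 0≤+
             (*-monoˡ-≤-0≤ (0≤weight F S) (avoiding≤uncovering S i p)) ⟩
      + 4 * (weight F S * uncovering S) ∎

  ones zeros : ℤ
  ones = ∑ (λ x → ⟦ andOn W x ⟧ * F x)
  zeros = ∑ (λ x → ⟦ andOn W x ⟧ * ⟦ not (f x) ⟧)

  0≤zeros : 0ℤ ℤ.≤ zeros
  0≤zeros = ∑-nonneg {n} (λ x → 0≤-* 0≤⟦ andOn W x ⟧ 0≤⟦ not (f x) ⟧)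

  0≤uncovering-W : 0ℤ ℤ.≤ uncovering W
  0≤uncovering-W = ∑-nonneg {n} (λ z → 0≤-* (0≤F z) 0≤⟦ not (andOn W z) ⟧)

  -- For a Boolean function on a subcube of `ones + zeros` points the scaled variance is (ones +
  -- zeros) ones - ones², which is the product on the left.
  ones*zeros≤weight-outside-W : ones * zeros ℤ.≤ weight-outside-W
  ones*zeros≤weight-outside-W = +-cancelˡ-≤ (ones * ones) (begin
    ones * ones + ones * zeros
      ≡⟨ factor ones zeros ⟩
    (ones + zeros) * ones
      ≡⟨ cong₂ _*_
           (trans (sym (∑-+ {n} _ _)) (∑-cong {n} (λ x → split ⟦ andOn W x ⟧ (f x))))
           (∑-cong {n} (λ x → cong (⟦ andOn W x ⟧ *_) (idem (f x)))) ⟩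
    ∑ (λ x → ⟦ andOn W x ⟧) * ∑ (λ x → ⟦ andOn W x ⟧ * (F x * F x))
      ≤⟨ variance≤weight-outside F W ⟩
    ones * ones + weight-outside-W ∎)
    where
    open ℤ.≤-Reasoning
    factor : ∀ a b → a * a + a * b ≡ (a + b) * a
    factor = solve-∀
    idem : ∀ b → ⟦ b ⟧ ≡ ⟦ b ⟧ * ⟦ b ⟧
    idem false = refl
    idem true = refl
    split₀ : ∀ u → u * + 0 + u * + 1 ≡ u
    split₀ = solve-∀
    split₁ : ∀ u → u * + 1 + u * + 0 ≡ u
    split₁ = solve-∀
    split : ∀ u b → u * ⟦ b ⟧ + u * ⟦ not b ⟧ ≡ u
    split u false = split₀ u
    split u true = split₁ u

  size-split : size ≡ uncovering W + ones
  size-split = trans (∑-cong {n} (λ x → split (f x) (andOn W x))) (∑-+ {n} _ _)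
    where
    split : ∀ a b → ⟦ a ⟧ ≡ ⟦ a ⟧ * ⟦ not b ⟧ + ⟦ b ⟧ * ⟦ a ⟧
    split false false = refl
    split false true = refl
    split true false = refl
    split true true = refl

  disagreement : ∑ (λ x → ⟦ not (does (f x ≟B andOn W x)) ⟧) ≡ uncovering W + zeros
  disagreement = trans (∑-cong {n} (λ x → split (f x) (andOn W x))) (∑-+ {n} _ _)
    where
    split : ∀ a b → ⟦ not (does (a ≟B b)) ⟧ ≡ ⟦ a ⟧ * ⟦ not b ⟧ + ⟦ b ⟧ * ⟦ not a ⟧
    split false false = refl
    split false true = refl
    split true false = refl
    split true true = refl

  4-energy≤ : + 4 * energy ℤ.≤ + 4 * (pw n * failures)
  4-energy≤ = *-monoˡ-≤-0≤ {k = + 4} 0≤+ energy≤failures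

  uncovering-bound : size * size * uncovering W ℤ.≤ + 4 * (pw n * failures)
  uncovering-bound = ℤ.≤-trans size²-uncovering 4-energy≤

  zeros-bound : size * (ones * zeros) ℤ.≤ + 4 * (pw n * failures)
  zeros-bound = ℤ.≤-trans (*-monoˡ-≤-0≤ 0≤size ones*zeros≤weight-outside-W)
    (ℤ.≤-trans size-weight-outside-W 4-energy≤)

-- Arithmetic behind ε = δ³/16.

-- With δ = r/s the hypothesis on D is that the failure probability is at most δ³/16.
scaled-error-bound : ∀ {r s N a A q₁ q₀ D} → 0ℤ ℤ.< r → 0ℤ ℤ.< s → 0ℤ ℤ.< N →
  0ℤ ℤ.≤ a → 0ℤ ℤ.≤ A → 0ℤ ℤ.≤ q₀ → a ≡ A + q₁ →
  r * N ℤ.≤ s * a →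
  a * a * A ℤ.≤ + 4 * (N * D) →
  a * (q₁ * q₀) ℤ.≤ + 4 * (N * D) →
  + 16 * (s * s * s) * D ℤ.≤ r * r * r * (N * N) →
  s * (A + q₀) ℤ.≤ r * N
scaled-error-bound {r} {s} {N} {a} {A} {q₁} {q₀} {D} 0<r 0<s 0<N 0≤a 0≤A 0≤q₀ a≡ rN≤sa hA h₀ hD =
  ℤ.*-cancelˡ-≤-pos _ _ (+ 2) (begin
    + 2 * (s * (A + q₀))
      ≡⟨ e₁ s A q₀ ⟩
    + 2 * (s * A) + + 2 * (s * q₀)
      -- Each of the two kinds of error gets half of the budget δN.
      ≤⟨ ℤ.+-mono-≤ (ℤ.≤-trans 2sA≤4sA 4sA≤rN) 2sq₀≤rN ⟩
    r * N + r * N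
      ≡⟨ e₂ (r * N) ⟩
    + 2 * (r * N) ∎)
  where
  open ℤ.≤-Reasoning
  e₁ : ∀ s A q → + 2 * (s * (A + q)) ≡ + 2 * (s * A) + + 2 * (s * q)
  e₁ = solve-∀
  e₂ : ∀ x → x + x ≡ + 2 * x
  e₂ = solve-∀
  e₃ : ∀ s a A → s * a * (s * a) * (+ 4 * (s * A)) ≡ + 4 * (s * s * s) * (a * a * A)
  e₃ = solve-∀
  e₄ : ∀ c N D → + 4 * c * (+ 4 * (N * D)) ≡ N * (+ 16 * c * D)
  e₄ = solve-∀
  e₅ : ∀ r N → N * (r * r * r * (N * N)) ≡ r * N * (r * N) * (r * N)
  e₅ = solve-∀
  e₆ : ∀ s a q → s * a * (s * a) * (+ 2 * (s * q)) ≡ + 2 * (s * s * s) * (a * q * a)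
  e₆ = solve-∀
  e₇ : ∀ c a q p → + 2 * c * (a * q * (+ 2 * p)) ≡ + 4 * c * (a * (p * q))
  e₇ = solve-∀
  e₈ : ∀ x → + 2 * x + + 2 * x ≡ + 4 * x
  e₈ = solve-∀
  e₉ : ∀ s A q → s * (A + q) + s * (A + q) ≡ + 2 * (s * A) + s * (+ 2 * q)
  e₉ = solve-∀
  0≤c : ∀ k → 0ℤ ℤ.≤ + k * (s * s * s)
  0≤c k = 0≤-* {+ k} 0≤+ (0≤-* (0≤-* (ℤ.<⇒≤ 0<s) (ℤ.<⇒≤ 0<s)) (ℤ.<⇒≤ 0<s))
  0≤sA : 0ℤ ℤ.≤ + 2 * (s * A)
  0≤sA = 0≤-* {+ 2} 0≤+ (0≤-* (ℤ.<⇒≤ 0<s) 0≤A)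
  2sA≤4sA : + 2 * (s * A) ℤ.≤ + 4 * (s * A)
  2sA≤4sA = subst₂ ℤ._≤_ (ℤ.+-identityʳ _) (e₈ (s * A)) (ℤ.+-monoʳ-≤ (+ 2 * (s * A)) 0≤sA)
  0<rN : 0ℤ ℤ.< r * N
  0<rN = 0<-* 0<r 0<N
  0<rN² : 0ℤ ℤ.< r * N * (r * N)
  0<rN² = 0<-* 0<rN 0<rN
  rN²≤sa² : r * N * (r * N) ℤ.≤ s * a * (s * a)
  rN²≤sa² = ℤ.≤-trans (*-monoˡ-≤-0≤ (ℤ.<⇒≤ 0<rN) rN≤sa)
    (*-monoʳ-≤-0≤ (ℤ.≤-trans (ℤ.<⇒≤ 0<rN) rN≤sa) rN≤sa)
  -- Common to both errors: a factor (sa)² is traded for the smaller (rN)², the failure bound turns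
  -- the right side into (rN)³, and (rN)² cancels.
  finish : ∀ {x y} → 0ℤ ℤ.≤ x → s * a * (s * a) * x ℤ.≤ + 4 * (s * s * s) * y →
    y ℤ.≤ + 4 * (N * D) → x ℤ.≤ r * N
  finish {x} {y} 0≤x le₁ le₂ = ℤ.*-cancelˡ-≤-pos _ _ (r * N * (r * N)) {{positive 0<rN²}} (begin
    r * N * (r * N) * x               ≤⟨ *-monoʳ-≤-0≤ 0≤x rN²≤sa² ⟩
    s * a * (s * a) * x               ≤⟨ le₁ ⟩
    + 4 * (s * s * s) * y             ≤⟨ *-monoˡ-≤-0≤ (0≤c 4) le₂ ⟩
    + 4 * (s * s * s) * (+ 4 * (N * D)) ≡⟨ e₄ (s * s * s) N D ⟩
    N * (+ 16 * (s * s * s) * D)      ≤⟨ *-monoˡ-≤-0≤ (ℤ.<⇒≤ 0<N) hD ⟩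
    N * (r * r * r * (N * N))         ≡⟨ e₅ r N ⟩
    r * N * (r * N) * (r * N)         ∎)
  4sA≤rN : + 4 * (s * A) ℤ.≤ r * N
  4sA≤rN = finish (0≤-* {+ 4} 0≤+ (0≤-* (ℤ.<⇒≤ 0<s) 0≤A))
    (ℤ.≤-reflexive (e₃ s a A)) hA
  -- The bound on A gives A ≤ a/4, more than enough for q₁ to be at least a/2.
  a≤2q₁ : a ℤ.≤ + 2 * q₁
  a≤2q₁ = ℤ.*-cancelˡ-≤-pos _ _ s {{positive 0<s}} (+-cancelˡ-≤ (s * a) (begin
    s * a + s * a
      ≡⟨ cong (λ b → s * b + s * b) a≡ ⟩
    s * (A + q₁) + s * (A + q₁)
      ≡⟨ e₉ s A q₁ ⟩
    + 2 * (s * A) + s * (+ 2 * q₁)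
      ≤⟨ ℤ.+-monoˡ-≤ (s * (+ 2 * q₁)) (ℤ.≤-trans 2sA≤4sA (ℤ.≤-trans 4sA≤rN rN≤sa)) ⟩
    s * a + s * (+ 2 * q₁) ∎))
  -- Replacing one factor a by 2q₁ produces the product q₁q₀ that `h₀` controls. The constant 16 is
  -- the 4 in `h₀` times this 2 times the 2 from halving the budget.
  2sq₀≤rN : + 2 * (s * q₀) ℤ.≤ r * N
  2sq₀≤rN = finish (0≤-* {+ 2} 0≤+ (0≤-* (ℤ.<⇒≤ 0<s) 0≤q₀)) (begin
    s * a * (s * a) * (+ 2 * (s * q₀))     ≡⟨ e₆ s a q₀ ⟩
    + 2 * (s * s * s) * (a * q₀ * a)
      ≤⟨ *-monoˡ-≤-0≤ (0≤c 2) (*-monoˡ-≤-0≤ (0≤-* 0≤a 0≤q₀) a≤2q₁) ⟩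
    + 2 * (s * s * s) * (a * q₀ * (+ 2 * q₁)) ≡⟨ e₇ (s * s * s) a q₀ q₁ ⟩
    + 4 * (s * s * s) * (a * (q₁ * q₀))    ∎) h₀

-- From filtered lists to sums over the cube.

∑ˡ : (A → ℤ) → List A → ℤ
∑ˡ g [] = 0ℤ
∑ˡ g (x ∷ xs) = g x + ∑ˡ g xs

∑ˡ-++ : (g : A → ℤ) (xs ys : List A) → ∑ˡ g (xs ++ ys) ≡ ∑ˡ g xs + ∑ˡ g ys
∑ˡ-++ g [] ys = sym (ℤ.+-identityˡ _)
∑ˡ-++ g (x ∷ xs) ys = trans (cong (λ k → g x + k) (∑ˡ-++ g xs ys)) (sym (ℤ.+-assoc (g x) _ _))

∑ˡ-map : (g : B → ℤ) (h : A → B) (xs : List A) → ∑ˡ g (map h xs) ≡ ∑ˡ (g ∘ h) xs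
∑ˡ-map g h [] = refl
∑ˡ-map g h (x ∷ xs) = cong (λ k → g (h x) + k) (∑ˡ-map g h xs)

∑ˡ-cartesianProduct : (g : A × B → ℤ) (xs : List A) (ys : List B) →
  ∑ˡ g (cartesianProduct xs ys) ≡ ∑ˡ (λ x → ∑ˡ (λ y → g (x , y)) ys) xs
∑ˡ-cartesianProduct g [] ys = refl
∑ˡ-cartesianProduct g (x ∷ xs) ys = trans (∑ˡ-++ g (map (x ,_) ys) _)
  (cong₂ _+_ (∑ˡ-map g (x ,_) ys) (∑ˡ-cartesianProduct g xs ys))

∑ˡ-cong : {g h : A → ℤ} → (∀ x → g x ≡ h x) → ∀ xs → ∑ˡ g xs ≡ ∑ˡ h xs
∑ˡ-cong e [] = refl
∑ˡ-cong e (x ∷ xs) = cong₂ _+_ (e x) (∑ˡ-cong e xs)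

∑ˡ-allCube : ∀ n (g : Cube n → ℤ) → ∑ˡ g (allCube n) ≡ ∑ g
∑ˡ-allCube zero g = ℤ.+-identityʳ _
∑ˡ-allCube (suc n) g = trans (extend (allCube n)) (∑ˡ-allCube n (λ x → g (false ∷ x) + g (true ∷ x)))
  where
  extend : ∀ xs → ∑ˡ g (concatMap (λ v → (false ∷ v) ∷ (true ∷ v) ∷ []) xs) ≡
    ∑ˡ (λ x → g (false ∷ x) + g (true ∷ x)) xs
  extend [] = refl
  extend (x ∷ xs) = trans (cong (λ k → g (false ∷ x) + (g (true ∷ x) + k)) (extend xs))
    (sym (ℤ.+-assoc (g (false ∷ x)) _ _))

length-filter≡∑ˡ : {P : A → Set} (P? : Decidable P) (xs : List A) →
  + length (filter P? xs) ≡ ∑ˡ (λ x → ⟦ does (P? x) ⟧) xs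
length-filter≡∑ˡ P? [] = refl
length-filter≡∑ˡ P? (x ∷ xs) with does (P? x)
... | false = trans (length-filter≡∑ˡ P? xs) (sym (ℤ.+-identityˡ _))
... | true = cong (λ k → + 1 + k) (length-filter≡∑ˡ P? xs)

pw≡2^ : ∀ n → pw n ≡ + (2 ℕ.^ n)
pw≡2^ zero = refl
pw≡2^ (suc n) = trans (pw-suc n) (trans (cong (+ 2 *_) (pw≡2^ n)) (sym (ℤ.pos-* 2 (2 ℕ.^ n))))

-- The hypothesis counts passing pairs, while the Fourier argument bounds failing ones.
failures-complement : ∀ (f : Cube n → Bool) →
  Test.failures f ≡ pw n * pw n + - ∑ (λ z → ∑ (λ x → ⟦ Test.passes f z x ⟧))
failures-complement {n} f = begin
  failures
    ≡⟨ add-sub failures G ⟩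
  (failures + G) + - G
    ≡⟨ cong (λ k → k + - G) (begin
         failures + G
           ≡⟨ ∑-+ {n} _ _ ⟨
         ∑ (λ z → ∑ (λ x → ⟦ not (passes z x) ⟧) + ∑ (λ x → ⟦ passes z x ⟧))
           ≡⟨ ∑-cong {n} (λ z → trans (sym (∑-+ {n} _ _)) (∑-cong {n} (λ x → total (passes z x)))) ⟩
         ∑ {n} (λ z → pw n)
           ≡⟨ ∑-cong {n} (λ z → sym (ℤ.*-identityʳ (pw n))) ⟩
         ∑ {n} (λ z → pw n * + 1)
           ≡⟨ ∑-*ˡ {n} (pw n) _ ⟩
         pw n * pw n ∎) ⟩
  pw n * pw n + - G ∎
  where
  open ≡-Reasoning
  open Test f
  G : ℤ
  G = ∑ (λ z → ∑ (λ x → ⟦ passes z x ⟧))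
  add-sub : ∀ a b → a ≡ (a + b) + - b
  add-sub = solve-∀
  total : ∀ b → ⟦ not b ⟧ + ⟦ b ⟧ ≡ + 1
  total false = refl
  total true = refl

-- From rational probabilities to integer inequalities.

/≤ : ∀ p i d .{{_ : ℕ.NonZero d}} → i * ℚ.denominator p ℤ.≤ ℚ.numerator p * + d → i / d ≤ p
/≤ p@record{} i (suc d) le =
  ℚ.toℚᵘ-cancel-≤ (ℚᵘ.≤-respˡ-≃ (ℚᵘ.≃-sym (ℚ.toℚᵘ-fromℚᵘ (mkℚᵘ i d))) (*≤* le))

-- `mkℚᵘ x y` is x/(y + 1). The comparison passes to unnormalised rationals, where the order is
-- cross-multiplication.
1-≤/ : ∀ x y i d .{{_ : ℕ.NonZero d}} → 1ℚ - fromℚᵘ (mkℚᵘ x y) ≤ i / d →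
  (+ suc y + - x) * + d ℤ.≤ i * + suc y
1-≤/ x y i (suc d) le with ℚᵘ.≤-respʳ-≃ (ℚ.toℚᵘ-fromℚᵘ (mkℚᵘ i d))
  (ℚᵘ.≤-respˡ-≃ (ℚᵘ.≃-trans (ℚ.toℚᵘ-homo-+ 1ℚ (ℚ.- fromℚᵘ (mkℚᵘ x y)))
    (ℚᵘ.+-congʳ 1ℚᵘ (ℚᵘ.≃-trans (ℚ.toℚᵘ-homo‿- (fromℚᵘ (mkℚᵘ x y)))
      (ℚᵘ.-‿cong (ℚ.toℚᵘ-fromℚᵘ (mkℚᵘ x y))))))
    (ℚ.toℚᵘ-mono-≤ le))
... | *≤* q = subst₂ ℤ._≤_ (lhs (+ suc y) x (+ suc d)) (cong (λ k → i * + k) (ℕ.*-identityˡ (suc y))) q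
  where
  lhs : ∀ b a c → (+ 1 * b + - a * + 1) * c ≡ (b + - a) * c
  lhs = solve-∀

prDisagree≤ : ∀ (p : ℚ) (f h : Cube n → Bool) →
  ∑ (λ x → ⟦ not (does (f x ≟B h x)) ⟧) * ℚ.denominator p ℤ.≤ ℚ.numerator p * pw n →
  prDisagree n f h ≤ p
prDisagree≤ {n} p f h le = /≤ p (+ length (filter differ? (allCube n))) (2 ℕ.^ n) {{ℕ.m^n≢0 2 n}}
  (subst₂ ℤ._≤_ (cong (_* ℚ.denominator p) (sym count)) (cong (ℚ.numerator p *_) (pw≡2^ n)) le)
  where
  differ? : Decidable (λ x → ¬ f x ≡ h x)
  differ? x = ¬? (f x ≟B h x)
  count : + length (filter differ? (allCube n)) ≡ ∑ (λ x → ⟦ does (differ? x) ⟧)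
  count = trans (length-filter≡∑ˡ differ? (allCube n)) (∑ˡ-allCube n (λ x → ⟦ does (differ? x) ⟧))

prAndTest≥ : ∀ x y (f : Cube n → Bool) → 1ℚ - fromℚᵘ (mkℚᵘ x y) ≤ prAndTest n f →
  + suc y * Test.failures f ℤ.≤ x * (pw n * pw n)
prAndTest≥ {n} x y f le = subst (λ D → + suc y * D ℤ.≤ x * N²) (sym (failures-complement f))
  (subst₂ ℤ._≤_ (e₁ (+ suc y) x N² G) (e₂ (+ suc y) x N² G)
    -- Adding xN² - (y + 1)G to both sides turns the lower bound on passes into an upper bound on
    -- failures.
    (ℤ.+-monoʳ-≤ (x * N² + - (+ suc y * G)) bound))
  where
  open Test f
  N² G : ℤ
  N² = pw n * pw n
  G = ∑ (λ z → ∑ (λ x → ⟦ passes z x ⟧))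
  pass? : Decidable (λ p → f (proj₁ p ⋀ proj₂ p) ≡ f (proj₁ p) ∧ f (proj₂ p))
  pass? p = f (proj₁ p ⋀ proj₂ p) ≟B (f (proj₁ p) ∧ f (proj₂ p))
  pairs : List (Cube n × Cube n)
  pairs = cartesianProduct (allCube n) (allCube n)
  count : + length (filter pass? pairs) ≡ G
  count = trans (length-filter≡∑ˡ pass? pairs)
    (trans (∑ˡ-cartesianProduct (λ p → ⟦ does (pass? p) ⟧) (allCube n) (allCube n))
      (trans (∑ˡ-cong (λ z → ∑ˡ-allCube n (λ x → ⟦ passes z x ⟧)) (allCube n))
        (∑ˡ-allCube n (λ z → ∑ (λ x → ⟦ passes z x ⟧)))))
  2^n²≡N² : + ((2 ℕ.^ n) ℕ.* (2 ℕ.^ n)) ≡ N²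
  2^n²≡N² = trans (ℤ.pos-* (2 ℕ.^ n) (2 ℕ.^ n)) (cong (λ k → k * k) (sym (pw≡2^ n)))
  bound : (+ suc y + - x) * N² ℤ.≤ G * + suc y
  bound = subst₂ ℤ._≤_ (cong ((+ suc y + - x) *_) 2^n²≡N²) (cong (_* + suc y) count)
    (1-≤/ x y (+ length (filter pass? pairs)) ((2 ℕ.^ n) ℕ.* (2 ℕ.^ n))
      {{ℕ.m*n≢0 (2 ℕ.^ n) (2 ℕ.^ n) {{ℕ.m^n≢0 2 n}} {{ℕ.m^n≢0 2 n}}}} le)
  e₁ : ∀ b a m g → (a * m + - (b * g)) + (b + - a) * m ≡ b * (m + - g)
  e₁ = solve-∀
  e₂ : ∀ b a m g → (a * m + - (b * g)) + g * b ≡ a * m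
  e₂ = solve-∀

-- The dichotomy and the choice of ε.

close-to-constant-or-AND : ∀ δ → 0ℤ ℤ.< ℚ.numerator δ → ∀ y →
  + suc y ≡ + 16 * (ℚ.denominator δ * ℚ.denominator δ * ℚ.denominator δ) →
  ∀ n (f : Cube n → Bool) →
  1ℚ - fromℚᵘ (mkℚᵘ (ℚ.numerator δ * ℚ.numerator δ * ℚ.numerator δ) y) ≤ prAndTest n f →
  Σ (Cube n → Bool) (λ h →
    ((Σ Bool (λ b → (x : Cube n) → h x ≡ b))
      ⊎ (Σ (Subset n) (λ S → (x : Cube n) → h x ≡ andOn S x)))
    × prDisagree n f h ≤ δ)
close-to-constant-or-AND δ 0<r y y≡ n f le = decide (size * s ℤ.≤? r * pw n)
  where
  open Test f
  r s : ℤ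
  r = ℚ.numerator δ
  s = ℚ.denominator δ
  never : ∀ b → ⟦ b ⟧ ≡ ⟦ not (does (b ≟B false)) ⟧
  never false = refl
  never true = refl
  0<pw : 0ℤ ℤ.< pw n
  0<pw = subst (0ℤ ℤ.<_) (sym (pw≡2^ n)) (ℤ.+<+ (ℕ.m^n>0 2 n))
  few-failures : + 16 * (s * s * s) * failures ℤ.≤ r * r * r * (pw n * pw n)
  few-failures = subst (λ k → k * failures ℤ.≤ r * r * r * (pw n * pw n)) y≡
    (prAndTest≥ (r * r * r) y f le)
  decide : Dec (size * s ℤ.≤ r * pw n) → _
  -- Density at most δ: f differs from the constant `false` exactly on F.
  decide (yes small) = (λ _ → false) , inj₁ (false , λ _ → refl) ,
    prDisagree≤ δ f _ (subst (λ k → k * s ℤ.≤ r * pw n) (∑-cong {n} (λ x → never (f x))) small)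
  -- Density above δ supplies the lower bound on `size` by which the error bound divides.
  decide (no large) = andOn W , inj₂ (W , λ _ → refl) ,
    prDisagree≤ δ f _ (ℤ.≤-trans
      (ℤ.≤-reflexive (trans (cong (_* s) disagreement) (ℤ.*-comm (uncovering W + zeros) s)))
      (scaled-error-bound {r} {s} {pw n} {size} {uncovering W} {ones} {zeros} {failures} 0<r (ℤ.+<+ (ℕ.s≤s ℕ.z≤n)) 0<pw
        0≤size 0≤uncovering-W 0≤zeros size-split
        (ℤ.≤-trans {r * pw n} {size * s} {s * size} (ℤ.<⇒≤ (ℤ.≰⇒> large)) (ℤ.≤-reflexive (ℤ.*-comm size s)))
        uncovering-bound zeros-bound few-failures))

0<⇒≡+suc : ∀ {i} → 0ℤ ℤ.< i → ∃ λ y → + suc y ≡ i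
0<⇒≡+suc {ℤ.+[1+ y ]} _ = y , refl
0<⇒≡+suc {+ zero} (ℤ.+<+ ())

0<numerator : ∀ {p} → 0ℚ < p → 0ℤ ℤ.< ℚ.numerator p
0<numerator {p} (*<* q) = subst (0ℤ ℤ.<_) (ℤ.*-identityʳ (ℚ.numerator p)) q

0<fromℚᵘ : ∀ {x} y → 0ℤ ℤ.< x → 0ℚ < fromℚᵘ (mkℚᵘ x y)
0<fromℚᵘ {x} y 0<x = ℚ.toℚᵘ-cancel-< (ℚᵘ.<-respʳ-≃ (ℚᵘ.≃-sym (ℚ.toℚᵘ-fromℚᵘ (mkℚᵘ x y)))
  (*<* (subst (0ℤ ℤ.<_) (sym (ℤ.*-identityʳ x)) 0<x)))

theorem1p1 : (δ : ℚ) → 0ℚ < δ →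
    Σ ℚ (λ ε → 0ℚ < ε ×
    ((n : ℕ) (f : Cube n → Bool) →
    1ℚ - ε ≤ prAndTest n f →
    Σ (Cube n → Bool) (λ h →
    ((Σ Bool (λ b → (x : Cube n) → h x ≡ b))
    ⊎ (Σ (Subset n) (λ S → (x : Cube n) → h x ≡ andOn S x)))
    × prDisagree n f h ≤ δ)))
theorem1p1 δ 0<δ =
  let 0<r = 0<numerator 0<δ
      0<s : 0ℤ ℤ.< ℚ.denominator δ
      0<s = ℤ.+<+ (ℕ.s≤s ℕ.z≤n)
      y , y≡ = 0<⇒≡+suc (0<-* {+ 16} (ℤ.+<+ (ℕ.s≤s ℕ.z≤n)) (0<-* (0<-* 0<s 0<s) 0<s))
  -- The witness is inferred as r³/(y + 1) = δ³/16, fixed before n and f.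
  in _ , 0<fromℚᵘ y (0<-* (0<-* 0<r 0<r) 0<r) , close-to-constant-or-AND δ 0<r y y≡
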